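{- Let $\mathbf{R}=\langle R,+,\cdot,0,1,\alpha\rangle$ be a Łukasiewicz near semiring. Define $x\oplus y=\alpha\big((\alpha(x)+y)\cdot\alpha(y)\big)$ for $x,y\in R$. Then the structure $\mathbf{B}(\mathbf{R})=\langle R,\oplus,\alpha,0\rangle$ (with $\alpha$ playing the role of the unary operation $'$) is a basic algebra.
   Context: A near semiring is an algebra $\langle R,+,\cdot,0,1\rangle$ such that: (i) $\langle R,+,0\rangle$ is a commutative monoid; (ii) $x\cdot 1=x=1\cdot x$ (multiplication need not be associative or commutative); (iii) $(x+y)\cdot z=(x\cdot z)+(y\cdot z)$; (iv) $x\cdot 0=0\cdot x=0$. It is idempotent if $x+x=x$; then $x\le y$ iff $x+y=y$ defines a partial order, called the induced order. An involutive near semiring is an idempotent near semiring with a map $\alpha:R\to R$ such that $\alpha(\alpha(x))=x$, and $x\le y$ implies $\alpha(y)\le\alpha(x)$. A Łukasiewicz near semiring is an involutive near semiring satisfying the identity $\alpha(x\cdot\alpha(y))\cdot\alpha(y)=\alpha(y\cdot\alpha(x))\cdot\alpha(x)$. A basic algebra is an algebra $\langle A,\oplus,{}',0\rangle$ of type $\langle 2,1,0\rangle$ satisfying, with $1:=0'$: (BA1) $x\oplus 0=x$; (BA2) $x''=x$; (BA3) $(x'\oplus y)'\oplus y=(y'\oplus x)'\oplus x$; (BA4) $(((x\oplus y)'\oplus y)'\oplus z)'\oplus(x\oplus z)=1$. -}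

module Defs where

open import Level using (Level; suc; _⊔_)
open import Algebra.Core using (Op₁; Op₂)
open import Algebra.Structures using (IsCommutativeMonoid)
import Algebra.Definitions
open import Relation.Binary.Core using (Rel)
open import Relation.Binary.Structures using (IsEquivalence)

-- As in the standard library, algebras live on setoids: identities are stated
-- up to _≈_, and every operation is required to respect _≈_.

module _ {a ℓ : Level} {A : Set a} (_≈_ : Rel A ℓ) where

  open Algebra.Definitions _≈_

  -- Unlike Algebra.Structures.IsNearSemiring, multiplication is not assumed
  -- associative, while addition is commutative, there is a unit for
  -- multiplication, and 0# annihilates on both sides.
  record IsNearSemiring (_+_ _*_ : Op₂ A) (0# 1# : A) : Set (a ⊔ ℓ) where
    field
      +-isCommutativeMonoid : IsCommutativeMonoid _≈_ _+_ 0#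
      *-cong                : Congruent₂ _*_
      *-identity            : Identity 1# _*_
      distribʳ              : _*_ DistributesOverʳ _+_
      zero                  : Zero 0# _*_

  record IsIdempotentNearSemiring (_+_ _*_ : Op₂ A) (0# 1# : A) : Set (a ⊔ ℓ) where
    field
      isNearSemiring : IsNearSemiring _+_ _*_ 0# 1#
      +-idem         : Idempotent _+_

    open IsNearSemiring isNearSemiring public

    infix 4 _≤_
    _≤_ : Rel A ℓ
    x ≤ y = (x + y) ≈ y

  record IsInvolutiveNearSemiring
           (_+_ _*_ : Op₂ A) (0# 1# : A) (α : Op₁ A) : Set (a ⊔ ℓ) where
    field
      isIdempotentNearSemiring : IsIdempotentNearSemiring _+_ _*_ 0# 1#

    open IsIdempotentNearSemiring isIdempotentNearSemiring public

    field
      α-cong       : Congruent₁ α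
      α-involutive : Involutive α
      α-antitone   : ∀ {x y} → x ≤ y → α y ≤ α x

  record IsŁukasiewiczNearSemiring
           (_+_ _*_ : Op₂ A) (0# 1# : A) (α : Op₁ A) : Set (a ⊔ ℓ) where
    field
      isInvolutiveNearSemiring : IsInvolutiveNearSemiring _+_ _*_ 0# 1# α
      łukasiewicz : ∀ x y → (α (x * α y) * α y) ≈ (α (y * α x) * α x)

    open IsInvolutiveNearSemiring isInvolutiveNearSemiring public

  record IsBasicAlgebra (_⊕_ : Op₂ A) (_′ : Op₁ A) (0# : A) : Set (a ⊔ ℓ) where
    1# : A
    1# = 0# ′

    field
      isEquivalence : IsEquivalence _≈_
      ⊕-cong        : Congruent₂ _⊕_
      ′-cong        : Congruent₁ _′
      BA1 : ∀ x → (x ⊕ 0#) ≈ x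
      BA2 : ∀ x → ((x ′) ′) ≈ x
      BA3 : ∀ x y → ((((x ′) ⊕ y) ′) ⊕ y) ≈ ((((y ′) ⊕ x) ′) ⊕ x)
      BA4 : ∀ x y z →
            (((((((x ⊕ y) ′) ⊕ y) ′) ⊕ z) ′) ⊕ (x ⊕ z)) ≈ 1#

record ŁukasiewiczNearSemiring (c ℓ : Level) : Set (suc (c ⊔ ℓ)) where
  infix  4 _≈_
  infixl 6 _+_
  infixl 7 _*_
  field
    Carrier : Set c
    _≈_     : Rel Carrier ℓ
    _+_     : Op₂ Carrier
    _*_     : Op₂ Carrier
    0#      : Carrier
    1#      : Carrier
    α       : Op₁ Carrier
    isŁukasiewiczNearSemiring : IsŁukasiewiczNearSemiring _≈_ _+_ _*_ 0# 1# α

  open IsŁukasiewiczNearSemiring isŁukasiewiczNearSemiring public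

{-# OPTIONS --safe #-}
module Submission where

open import Defs
open import Level using (Level)
open import Algebra.Core using (Op₂)
open import Algebra.Definitions using (Congruent₂)
open import Algebra.Structures using (IsCommutativeMonoid)
open import Data.Product using (proj₁; proj₂)
import Relation.Binary.Reasoning.Setoid as SetoidReasoning

-- The Łukasiewicz identity at x = 0, y = 1 gives α 0 · α 1 = 0. Since α 0 is the
-- top element, α 1 = 1 · α 1 ≤ α 0 · α 1, so α 1 = 0; the identity at x = 1 then
-- gives y · α y = 0. Right distributivity therefore collapses
-- x ⊕ y to α (α x · α y). In this form (BA3) is the Łukasiewicz identity, and
-- (BA4) says α b · a = 0 for a = α x · α z and b = w · α z, where
-- w = α (α (α x · α y) · α y). This holds because a ≤ b, since α x ≤ w by the
-- Łukasiewicz identity and right multiplication is monotone.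

module Properties {c ℓ : Level} (R : ŁukasiewiczNearSemiring c ℓ) where
  open ŁukasiewiczNearSemiring R
  open IsCommutativeMonoid +-isCommutativeMonoid
    using (refl; sym; trans; setoid; isEquivalence)
    renaming (∙-cong to +-cong; identityˡ to +-identityˡ; identityʳ to +-identityʳ)
  open SetoidReasoning setoid

  *-identityˡ : ∀ x → 1# * x ≈ x
  *-identityˡ = proj₁ *-identity

  *-identityʳ : ∀ x → x * 1# ≈ x
  *-identityʳ = proj₂ *-identity

  zeroˡ : ∀ x → 0# * x ≈ 0#
  zeroˡ = proj₁ zero

  zeroʳ : ∀ x → x * 0# ≈ 0#
  zeroʳ = proj₂ zero

  ≤-resp : ∀ {x x′ y y′} → x ≈ x′ → y ≈ y′ → x ≤ y → x′ ≤ y′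
  ≤-resp x≈x′ y≈y′ x≤y =
    trans (+-cong (sym x≈x′) (sym y≈y′)) (trans x≤y y≈y′)

  x≤0⇒x≈0 : ∀ {x} → x ≤ 0# → x ≈ 0#
  x≤0⇒x≈0 {x} x≤0 = trans (sym (+-identityʳ x)) x≤0

  *-monoˡ-≤ : ∀ z {x y} → x ≤ y → x * z ≤ y * z
  *-monoˡ-≤ z {x} {y} x≤y =
    trans (sym (distribʳ z x y)) (*-cong x≤y refl)

  -- As the unit of `+`, `0#` lies below `α x`; `α` reverses this.
  x≤α0 : ∀ x → x ≤ α 0#
  x≤α0 x = ≤-resp (α-involutive x) refl (α-antitone (+-identityˡ (α x)))

  α0*α1≈0 : α 0# * α 1# ≈ 0#
  α0*α1≈0 = begin
    α 0# * α 1#                  ≈⟨ *-cong (α-cong (zeroˡ (α 1#))) refl ⟨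
    α (0# * α 1#) * α 1#         ≈⟨ łukasiewicz 0# 1# ⟩
    α (1# * α 0#) * α 0#         ≈⟨ *-cong (α-cong (*-identityˡ (α 0#))) refl ⟩
    α (α 0#) * α 0#              ≈⟨ *-cong (α-involutive 0#) refl ⟩
    0# * α 0#                    ≈⟨ zeroˡ (α 0#) ⟩
    0#                           ∎

  α1≈0 : α 1# ≈ 0#
  α1≈0 = x≤0⇒x≈0
    (≤-resp (*-identityˡ (α 1#)) α0*α1≈0 (*-monoˡ-≤ (α 1#) (x≤α0 1#)))

  α0≈1 : α 0# ≈ 1#
  α0≈1 = trans (α-cong (sym α1≈0)) (α-involutive 1#)

  x≤1 : ∀ x → x ≤ 1#
  x≤1 x = ≤-resp refl α0≈1 (x≤α0 x)

  -- Monotonicity comes from right distributivity, so it acts on the left factor: replacing that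
  -- factor by the top element `1#` leaves `y`.
  x*y≤y : ∀ x y → x * y ≤ y
  x*y≤y x y = ≤-resp refl (*-identityˡ y) (*-monoˡ-≤ y (x≤1 x))

  x*αx≈0 : ∀ x → x * α x ≈ 0#
  x*αx≈0 x = begin
    -- The left factor `x` is rewritten as `α (1# * α x)` to match one side of `łukasiewicz`; the
    -- other side ends in `α 1#`, which is zero.
    x * α x               ≈⟨ *-cong (trans (α-cong (*-identityˡ (α x))) (α-involutive x)) refl ⟨
    α (1# * α x) * α x    ≈⟨ łukasiewicz 1# x ⟩
    α (x * α 1#) * α 1#   ≈⟨ *-cong refl α1≈0 ⟩
    α (x * α 1#) * 0#     ≈⟨ zeroʳ _ ⟩
    0#                    ∎

  -- Since `α y ≤ α x`, the product lies below `α x * x`, which vanishes.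
  x≤y⇒αy*x≈0 : ∀ {x y} → x ≤ y → α y * x ≈ 0#
  x≤y⇒αy*x≈0 {x} {y} x≤y = x≤0⇒x≈0
    (≤-resp refl αx*x≈0 (*-monoˡ-≤ x (α-antitone x≤y)))
    where
    αx*x≈0 : α x * x ≈ 0#
    αx*x≈0 = trans (*-cong refl (sym (α-involutive x))) (x*αx≈0 (α x))

  -- The Łukasiewicz identity trades the inner product for one with right factor `α x`, hence below
  -- `α x`; applying `α` gives the bound.
  x≤α[α[x*αy]*αy] : ∀ x y → x ≤ α (α (x * α y) * α y)
  x≤α[α[x*αy]*αy] x y =
    ≤-resp (α-involutive x) (α-cong (sym (łukasiewicz x y)))
      (α-antitone (x*y≤y (α (y * α x)) (α x)))

  _⊕_ : Op₂ Carrier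
  x ⊕ y = α ((α x + y) * α y)

  ⊕-cong : Congruent₂ _≈_ _⊕_
  ⊕-cong x≈x′ y≈y′ =
    α-cong (*-cong (+-cong (α-cong x≈x′) y≈y′) (α-cong y≈y′))

  ⊕≈α[αx*αy] : ∀ x y → x ⊕ y ≈ α (α x * α y)
  ⊕≈α[αx*αy] x y = α-cong (begin
    (α x + y) * α y        ≈⟨ distribʳ (α y) (α x) y ⟩
    α x * α y + y * α y    ≈⟨ +-cong refl (x*αx≈0 y) ⟩
    α x * α y + 0#         ≈⟨ +-identityʳ _ ⟩
    α x * α y              ∎)

  α[x⊕y] : ∀ x y → α (x ⊕ y) ≈ α x * α y
  α[x⊕y] x y = trans (α-cong (⊕≈α[αx*αy] x y)) (α-involutive _)

  -- Both sides of (BA3), and the inner and outer layers of (BA4), have this shape.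
  α[x⊕y]⊕z : ∀ x y z → α (x ⊕ y) ⊕ z ≈ α (α (α x * α y) * α z)
  α[x⊕y]⊕z x y z =
    trans (⊕≈α[αx*αy] _ z) (α-cong (*-cong (α-cong (α[x⊕y] x y)) refl))

  ⊕-identityʳ : ∀ x → x ⊕ 0# ≈ x
  ⊕-identityʳ x = begin
    x ⊕ 0#            ≈⟨ ⊕≈α[αx*αy] x 0# ⟩
    α (α x * α 0#)    ≈⟨ α-cong (*-cong refl α0≈1) ⟩
    α (α x * 1#)      ≈⟨ α-cong (*-identityʳ (α x)) ⟩
    α (α x)           ≈⟨ α-involutive x ⟩
    x                 ∎

  ⊕-łukasiewicz : ∀ x y → α (α x ⊕ y) ⊕ y ≈ α (α y ⊕ x) ⊕ x
  ⊕-łukasiewicz x y = begin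
    α (α x ⊕ y) ⊕ y                 ≈⟨ α[αx⊕y]⊕y x y ⟩
    α (α (x * α y) * α y)           ≈⟨ α-cong (łukasiewicz x y) ⟩
    α (α (y * α x) * α x)           ≈⟨ α[αx⊕y]⊕y y x ⟨
    α (α y ⊕ x) ⊕ x                 ∎
    where
    α[αx⊕y]⊕y : ∀ x y → α (α x ⊕ y) ⊕ y ≈ α (α (x * α y) * α y)
    α[αx⊕y]⊕y x y = trans (α[x⊕y]⊕z (α x) y y)
      (α-cong (*-cong (α-cong (*-cong (α-involutive x) refl)) refl))

  ⊕-BA4 : ∀ x y z → α (α (α (x ⊕ y) ⊕ y) ⊕ z) ⊕ (x ⊕ z) ≈ α 0#
  ⊕-BA4 x y z = begin
    α (α w ⊕ z) ⊕ (x ⊕ z)                ≈⟨ α[x⊕y]⊕z (α w) z (x ⊕ z) ⟩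
    α (α (α (α w) * α z) * α (x ⊕ z))    ≈⟨ α-cong (*-cong (α-cong (*-cong (α-involutive w) refl)) (α[x⊕y] x z)) ⟩
    α (α (w * α z) * (α x * α z))        ≈⟨ α-cong (x≤y⇒αy*x≈0 (*-monoˡ-≤ (α z) αx≤w)) ⟩
    α 0#                                 ∎
    where
    -- This is the basic-algebra join of `α x` and `y`, which is why `α x` should lie below it.
    w : Carrier
    w = α (x ⊕ y) ⊕ y

    αx≤w : α x ≤ w
    αx≤w = ≤-resp refl (sym (α[x⊕y]⊕z x y y)) (x≤α[α[x*αy]*αy] (α x) y)

  isBasicAlgebra : IsBasicAlgebra _≈_ _⊕_ α 0#
  isBasicAlgebra = record
    { isEquivalence = isEquivalence
    ; ⊕-cong        = ⊕-cong
    ; ′-cong        = α-cong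
    ; BA1           = ⊕-identityʳ
    ; BA2           = α-involutive
    ; BA3           = ⊕-łukasiewicz
    ; BA4           = ⊕-BA4
    }

theorem4 : {c ℓ : Level} (R : ŁukasiewiczNearSemiring c ℓ) →
    let open ŁukasiewiczNearSemiring R in
    IsBasicAlgebra _≈_ (λ x y → α ((α x + y) * α y)) α 0#
theorem4 R = Properties.isBasicAlgebra R
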